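{- Let $M, N$ be positive integers and let $r$ be an integer with $0 \le r \le \min(M,N)$. Let $f_{(M \times N; r)}(q)$ be the generating function for partitions in the $M \times N$ box with exactly $r$ different part sizes. Then $$f_{(M \times N; r)}(q) = \sum_{r_0 = r}^{\min(M,N)} \binom{r_0}{r} (-1)^{r_0-r} q^{\binom{r_0+1}{2}} \left[ {M \atop {r_0}} \right]_q \left[ {{M+N-r_0} \atop {N-r_0}} \right]_q.$$
   Context: A partition lies in the $M \times N$ box if it has at most $N$ parts, each of size at most $M$. The generating function $f_{(M\times N;r)}(q)$ is $\sum_{\lambda} q^{|\lambda|}$, the sum being over all partitions $\lambda$ in the $M\times N$ box having exactly $r$ distinct part sizes, where $|\lambda|$ is the sum of the parts of $\lambda$; the empty partition has $r=0$. The $q$-binomial coefficient is $\left[ {A+B \atop B} \right]_q = \frac{(q)_{A+B}}{(q)_A (q)_B}$ for integers $A, B \ge 0$, where $(q)_m = (1-q)(1-q^2)\cdots(1-q^m)$. -}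

module Defs where

open import Data.Nat.Base as ℕ using (ℕ; zero; suc; _∸_; _≤_; _<_; s≤s)
import Data.Nat.Properties as ℕ
open import Data.Integer.Base as ℤ using (ℤ; 0ℤ; 1ℤ)
import Data.Integer.Properties as ℤ
open import Data.Integer.Tactic.RingSolver using (solve-∀)
open import Data.Bool.Base using (if_then_else_)
open import Data.Fin.Base using (toℕ)
open import Data.List.Base
  using (List; []; _∷_; [_]; length; map; foldr; filter; deduplicate; upTo;
         applyUpTo; cartesianProductWith)
open import Data.Nat.ListAction using (sum)
open import Data.List.Properties using (∷-injective)
open import Data.List.Membership.Propositional using (_∈_)
open import Data.List.Membership.Propositional.Properties
  using (∈-cartesianProductWith⁺; ∈-cartesianProductWith⁻; ∈-upTo⁺; ∈-filter⁺; ∈-filter⁻)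
open import Data.List.Relation.Unary.All as All using (All; []; _∷_)
open import Data.List.Relation.Unary.AllPairs using ([]; _∷_)
open import Data.List.Relation.Unary.Any using (here; there)
open import Data.List.Relation.Unary.Linked using (Linked; linked?)
open import Data.List.Relation.Unary.Unique.Propositional using (Unique)
import Data.List.Relation.Unary.Unique.Propositional.Properties as Unique
open import Data.Product.Base using (_×_; _,_; proj₁; proj₂)
open import Function.Bundles using (_⇔_; mk⇔)
open import Relation.Binary.PropositionalEquality
  using (_≡_; _≢_; _≗_; refl; trans; cong)
open import Relation.Nullary.Decidable using (_×-dec_)
open import Relation.Unary using (Decidable)
open import Algebra.Properties.Monoid.Sum ℤ.+-0-monoid using (sum⁺-syntax)

-- Formal power series in q over ℤ, as coefficient sequences.  Equality
-- of series is pointwise equality _≗_.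
Series : Set
Series = ℕ → ℤ

infixl 6 _⊕_ _⊖_
infixl 7 _⊗_ _⊘_ _·_
infix  8 q^_

0ₛ : Series
0ₛ _ = 0ℤ

q^_ : ℕ → Series
(q^ m) n = if m ℕ.≡ᵇ n then 1ℤ else 0ℤ

1ₛ : Series
1ₛ = q^ 0

_⊕_ _⊖_ _⊗_ : Series → Series → Series
(f ⊕ g) n = f n ℤ.+ g n
(f ⊖ g) n = f n ℤ.- g n
(f ⊗ g) n = ∑[ i ≤ n ] (f (toℕ i) ℤ.* g (n ∸ toℕ i))

_·_ : ℤ → Series → Series
(c · f) n = c ℤ.* f n

-- Long division: g ⊘ f = g 0 + q · (remainder g f ⊘ f).  This is the
-- quotient when f has constant term 1 (see ⊘-⊗) and meaningless otherwise.
remainder : Series → Series → Series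
remainder g f k = (g ⊖ g 0 · f) (suc k)

_⊘_ : Series → Series → Series
(g ⊘ f) zero    = g 0
(g ⊘ f) (suc n) = (remainder g f ⊘ f) n

⊘-⊗ : ∀ g f → f 0 ≡ 1ℤ → (g ⊘ f) ⊗ f ≗ g
⊘-⊗ g f f₀≡1 zero rewrite f₀≡1 = lemma (g 0)
  where
  lemma : ∀ a → a ℤ.* 1ℤ ℤ.+ 0ℤ ≡ a
  lemma = solve-∀
⊘-⊗ g f f₀≡1 (suc n) =
  trans (cong (λ z → g 0 ℤ.* f (suc n) ℤ.+ z) (⊘-⊗ (remainder g f) f f₀≡1 n))
        (lemma (g 0 ℤ.* f (suc n)) (g (suc n)))
  where
  lemma : ∀ a b → a ℤ.+ (b ℤ.- a) ≡ b
  lemma = solve-∀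

∑ : ∀ {a} {A : Set a} → List A → (A → Series) → Series
∑ xs f = foldr _⊕_ 0ₛ (map f xs)

infixr 5 ∑
syntax ∑ xs (λ x → t) = ∑[ x ∈ xs ] t

-- Both ends included; empty when b < a.
_⋯_ : ℕ → ℕ → List ℕ
a ⋯ b = applyUpTo (a ℕ.+_) (suc b ∸ a)

⦅q⦆ : ℕ → Series
⦅q⦆ zero    = 1ₛ
⦅q⦆ (suc m) = ⦅q⦆ m ⊗ (1ₛ ⊖ q^ suc m)

⦅q⦆₀≡1 : ∀ m → ⦅q⦆ m 0 ≡ 1ℤ
⦅q⦆₀≡1 zero    = refl
⦅q⦆₀≡1 (suc m) rewrite ⦅q⦆₀≡1 m = refl

⦅q⦆⊗⦅q⦆₀≡1 : ∀ a b → (⦅q⦆ a ⊗ ⦅q⦆ b) 0 ≡ 1ℤ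
⦅q⦆⊗⦅q⦆₀≡1 a b rewrite ⦅q⦆₀≡1 a | ⦅q⦆₀≡1 b = refl

-- (q)_{A+B} / ((q)_A (q)_B) with n = A + B, k = B; only meaningful for
-- k ≤ n.  The division is exact by ⊘-⊗ and ⦅q⦆⊗⦅q⦆₀≡1.
qBinomial : ℕ → ℕ → Series
qBinomial n k = ⦅q⦆ n ⊘ (⦅q⦆ (n ∸ k) ⊗ ⦅q⦆ k)

-- A partition is the weakly decreasing list of its positive parts.
IsPartition : List ℕ → Set
IsPartition λs = Linked ℕ._≥_ λs × All (0 <_) λs

InBox : ℕ → ℕ → List ℕ → Set
InBox M N λs = length λs ≤ N × All (_≤ M) λs

distinctPartSizes : List ℕ → ℕ
distinctPartSizes λs = length (deduplicate ℕ._≟_ λs)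

IsBoxPartition : ℕ → ℕ → ℕ → List ℕ → Set
IsBoxPartition M N r λs =
  IsPartition λs × InBox M N λs × distinctPartSizes λs ≡ r

isBoxPartition? : ∀ M N r → Decidable (IsBoxPartition M N r)
isBoxPartition? M N r λs =
  (linked? ℕ._≥?_ λs ×-dec All.all? (0 ℕ.<?_) λs)
    ×-dec (length λs ℕ.≤? N ×-dec All.all? (ℕ._≤? M) λs)
    ×-dec distinctPartSizes λs ℕ.≟ r

boxLists : ℕ → ℕ → List (List ℕ)
boxLists M zero    = [ [] ]
boxLists M (suc N) = [] ∷ cartesianProductWith _∷_ (upTo (suc M)) (boxLists M N)

boxPartitions : ℕ → ℕ → ℕ → List (List ℕ)
boxPartitions M N r = filter (isBoxPartition? M N r) (boxLists M N)

-- boxPartitions M N r lists each partition in the M × N box with exactly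
-- r distinct part sizes once, and nothing else.

∈-boxLists : ∀ M N {xs} → InBox M N xs → xs ∈ boxLists M N
∈-boxLists M zero    {[]}     _                    = here refl
∈-boxLists M (suc N) {[]}     _                    = here refl
∈-boxLists M (suc N) {x ∷ xs} (s≤s len , x≤M ∷ ps) =
  there (∈-cartesianProductWith⁺ _∷_ (∈-upTo⁺ (s≤s x≤M)) (∈-boxLists M N (len , ps)))

boxLists-unique : ∀ M N → Unique (boxLists M N)
boxLists-unique M zero    = [] ∷ []
boxLists-unique M (suc N) =
  All.tabulate (λ xs∈ []≡xs → nonempty xs∈ []≡xs)
    ∷ Unique.cartesianProductWith⁺ _∷_ ∷-injective
        (Unique.upTo⁺ (suc M)) (boxLists-unique M N)
  where
  nonempty : ∀ {xs} → xs ∈ cartesianProductWith _∷_ (upTo (suc M)) (boxLists M N) →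
             [] ≢ xs
  nonempty xs∈ refl
    with _ , _ , _ , _ , () ← ∈-cartesianProductWith⁻ _∷_ (upTo (suc M)) (boxLists M N) xs∈

∈-boxPartitions : ∀ M N r {λs} → λs ∈ boxPartitions M N r ⇔ IsBoxPartition M N r λs
∈-boxPartitions M N r = mk⇔
  (λ λs∈ → proj₂ (∈-filter⁻ (isBoxPartition? M N r) {xs = boxLists M N} λs∈))
  (λ p → ∈-filter⁺ (isBoxPartition? M N r) (∈-boxLists M N (proj₁ (proj₂ p))) p)

boxPartitions-unique : ∀ M N r → Unique (boxPartitions M N r)
boxPartitions-unique M N r =
  Unique.filter⁺ (isBoxPartition? M N r) (boxLists-unique M N)

boxGF : ℕ → ℕ → ℕ → Series
boxGF M N r = ∑[ λs ∈ boxPartitions M N r ] q^ sum λs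

{-# OPTIONS --safe #-}

-- Marking k of the part sizes of a partition in the M × N box and removing one
-- copy of each marked size leaves a partition in the M × (N - k) box together
-- with k distinct numbers in {1, …, M}.  Hence q^(k+1 choose 2) [M, k] [M+N-k, N-k]
-- is the generating function of the partitions with k marked sizes, and the
-- theorem is inclusion–exclusion over the marks.  With a variable t recording
-- the number of part sizes, splitting off a part equal to the largest allowed
-- size gives
--   F(M,N) = F(M-1,N) + q^M F(M,N-1) + (t - 1) q^M F(M-1,N-1);
-- by the two q-Pascal rules the right-hand side of the theorem satisfies the
-- same recurrence, t - 1 turning into the signed binomial coefficients of
-- (t - 1)^k.

module Submission where

open import Defs
open import Algebra.Bundles using (CommutativeSemiring)
open import Algebra.Structures using (IsCommutativeSemiring)
open import Data.Bool.Base using (true; false; if_then_else_)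
open import Data.Nat.Base as ℕ
  using (ℕ; zero; suc; _+_; _∸_; _≤_; _<_; _⊓_; NonZero; s≤s; z≤n; s≤s⁻¹)
import Data.Nat.Properties as ℕ
open import Data.Nat.Combinatorics
  using (_C_; nCk+nC[k+1]≡[n+1]C[k+1]; nC1≡n; k>n⇒nCk≡0)
open import Data.Nat.ListAction using (sum)
open import Data.Integer.Base as ℤ using (ℤ; 0ℤ; 1ℤ; +_; -1ℤ; _*_; _^_)
import Data.Integer.Properties as ℤ
open import Data.Integer.Tactic.RingSolver using (solve-∀)
open import Data.List.Base
  using (List; []; _∷_; foldr; applyUpTo; upTo; _++_; map; filter; length; deduplicate)
open import Data.List.Properties
  using (map-applyUpTo; map-∘; filter-all; filter-idem; filter-reject; ∷-injectiveʳ)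
open import Data.List.Membership.Propositional using (_∈_)
open import Data.List.Membership.Propositional.Properties
  using (∈-applyUpTo⁻; ∈-++⁺ˡ; ∈-++⁺ʳ; ∈-++⁻; ∈-map⁺; ∈-map⁻; ∈-filter⁺; ∈-filter⁻)
open import Data.List.Membership.Propositional.Properties.WithK using (unique∧set⇒bag)
open import Data.List.Relation.Binary.BagAndSetEquality using (∼bag⇒↭)
open import Data.List.Relation.Binary.Permutation.Propositional as ↭ using (_↭_)
open import Data.List.Relation.Unary.All as All using (All; []; _∷_)
import Data.List.Relation.Unary.All.Properties as All
open import Data.List.Relation.Unary.AllPairs using ([]; _∷_)
open import Data.List.Relation.Unary.Any using (here; there)
open import Data.List.Relation.Unary.Linked as Linked using (Linked; []; [-]; _∷_)
open import Data.List.Relation.Unary.Linked.Properties using (Linked⇒All)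
open import Data.List.Relation.Unary.Unique.Propositional using (Unique)
import Data.List.Relation.Unary.Unique.Propositional.Properties as Unique
open import Data.Product.Base using (_×_; _,_; proj₂)
open import Data.Sum.Base using (inj₁; inj₂)
open import Function.Base using (_∘_; id)
open import Function.Bundles using (mk⇔; Equivalence)
open import Level using (0ℓ)
open import Relation.Binary.PropositionalEquality
  using (_≡_; _≢_; _≗_; refl; sym; trans; cong; cong₂; subst; module ≡-Reasoning)
open import Relation.Nullary using (yes; no; ¬?; contradiction)
open import Relation.Nullary.Decidable using (does)
open import Algebra.Properties.AbelianGroup ℤ.+-0-abelianGroup using (∙-cancelʳ)

-- The commutative semiring of power series

tail : Series → Series
tail f n = f (suc n)

⊗-cong : ∀ {f f′ g g′} → f ≗ f′ → g ≗ g′ → f ⊗ g ≗ f′ ⊗ g′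
⊗-cong f≗ g≗ zero    = cong₂ (λ a b → a * b ℤ.+ 0ℤ) (f≗ 0) (g≗ 0)
⊗-cong f≗ g≗ (suc n) =
  cong₂ ℤ._+_ (cong₂ _*_ (f≗ 0) (g≗ (suc n))) (⊗-cong (f≗ ∘ suc) g≗ n)

0-⊗ : ∀ f → 0ₛ ⊗ f ≗ 0ₛ
0-⊗ f zero    = refl
0-⊗ f (suc n) = trans (ℤ.+-identityˡ _) (0-⊗ f n)

·-⊗ : ∀ c f g → (c · f) ⊗ g ≗ c · (f ⊗ g)
·-⊗ c f g zero    = lemma c (f 0) (g 0)
  where
  lemma : ∀ c a b → c * a * b ℤ.+ 0ℤ ≡ c * (a * b ℤ.+ 0ℤ)
  lemma = solve-∀
·-⊗ c f g (suc n) =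
  trans (cong (λ z → c * f 0 * g (suc n) ℤ.+ z) (·-⊗ c (tail f) g n))
        (lemma c (f 0) (g (suc n)) ((tail f ⊗ g) n))
  where
  lemma : ∀ c a b d → c * a * b ℤ.+ c * d ≡ c * (a * b ℤ.+ d)
  lemma = solve-∀

⊗-distribʳ : ∀ h f g → (f ⊕ g) ⊗ h ≗ (f ⊗ h) ⊕ (g ⊗ h)
⊗-distribʳ h f g zero    = lemma (h 0) (f 0) (g 0)
  where
  lemma : ∀ c a b → (a ℤ.+ b) * c ℤ.+ 0ℤ ≡ (a * c ℤ.+ 0ℤ) ℤ.+ (b * c ℤ.+ 0ℤ)
  lemma = solve-∀
⊗-distribʳ h f g (suc n) =
  trans (cong (λ z → (f 0 ℤ.+ g 0) * h (suc n) ℤ.+ z) (⊗-distribʳ h (tail f) (tail g) n))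
        (lemma (h (suc n)) (f 0) (g 0) ((tail f ⊗ h) n) ((tail g ⊗ h) n))
  where
  lemma : ∀ c a b d e → (a ℤ.+ b) * c ℤ.+ (d ℤ.+ e) ≡ (a * c ℤ.+ d) ℤ.+ (b * c ℤ.+ e)
  lemma = solve-∀

-- A product unfolds by definition along its left factor. Peeling the right factor instead is what
-- the induction for `⊗-comm` needs.
⊗-tailʳ : ∀ f g n → (f ⊗ g) (suc n) ≡ f (suc n) * g 0 ℤ.+ (f ⊗ tail g) n
⊗-tailʳ f g zero    = lemma (f 0) (f 1) (g 0) (g 1)
  where
  lemma : ∀ a b c d → a * d ℤ.+ (b * c ℤ.+ 0ℤ) ≡ b * c ℤ.+ (a * d ℤ.+ 0ℤ)
  lemma = solve-∀
⊗-tailʳ f g (suc n) =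
  trans (cong (λ z → f 0 * g (suc (suc n)) ℤ.+ z) (⊗-tailʳ (tail f) g n))
        (lemma (f 0 * g (suc (suc n))) (f (suc (suc n)) * g 0) ((tail f ⊗ tail g) n))
  where
  lemma : ∀ a b c → a ℤ.+ (b ℤ.+ c) ≡ b ℤ.+ (a ℤ.+ c)
  lemma = solve-∀

⊗-comm : ∀ f g → f ⊗ g ≗ g ⊗ f
⊗-comm f g zero    = cong (ℤ._+ 0ℤ) (ℤ.*-comm (f 0) (g 0))
⊗-comm f g (suc n) =
  trans (cong₂ ℤ._+_ (ℤ.*-comm (f 0) (g (suc n))) (⊗-comm (tail f) g n))
        (sym (⊗-tailʳ g f n))

⊗-assoc : ∀ f g h → (f ⊗ g) ⊗ h ≗ f ⊗ (g ⊗ h)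
⊗-assoc f g h zero    = lemma (f 0) (g 0) (h 0)
  where
  lemma : ∀ a b c → (a * b ℤ.+ 0ℤ) * c ℤ.+ 0ℤ ≡ a * (b * c ℤ.+ 0ℤ) ℤ.+ 0ℤ
  lemma = solve-∀
⊗-assoc f g h (suc n) = begin
  -- Here `tail (f ⊗ g)` has unfolded to `f 0 · tail g ⊕ tail f ⊗ g`.
  (f 0 * g 0 ℤ.+ 0ℤ) * h (suc n) ℤ.+ ((f 0 · tail g ⊕ tail f ⊗ g) ⊗ h) n
    ≡⟨ cong (λ z → (f 0 * g 0 ℤ.+ 0ℤ) * h (suc n) ℤ.+ z)
         (trans (⊗-distribʳ h (f 0 · tail g) (tail f ⊗ g) n)
                (cong₂ ℤ._+_ (·-⊗ (f 0) (tail g) h n) (⊗-assoc (tail f) g h n))) ⟩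
  (f 0 * g 0 ℤ.+ 0ℤ) * h (suc n) ℤ.+ (f 0 * (tail g ⊗ h) n ℤ.+ (tail f ⊗ (g ⊗ h)) n)
    ≡⟨ lemma (f 0) (g 0) (h (suc n)) ((tail g ⊗ h) n) ((tail f ⊗ (g ⊗ h)) n) ⟩
  f 0 * (g 0 * h (suc n) ℤ.+ (tail g ⊗ h) n) ℤ.+ (tail f ⊗ (g ⊗ h)) n ∎
  where
  open ≡-Reasoning
  lemma : ∀ a b c d e → (a * b ℤ.+ 0ℤ) * c ℤ.+ (a * d ℤ.+ e) ≡ a * (b * c ℤ.+ d) ℤ.+ e
  lemma = solve-∀

1-⊗ : ∀ f → 1ₛ ⊗ f ≗ f
1-⊗ f zero    = trans (ℤ.+-identityʳ _) (ℤ.*-identityˡ (f 0))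
1-⊗ f (suc n) =
  trans (cong₂ ℤ._+_ (ℤ.*-identityˡ (f (suc n))) (0-⊗ f n)) (ℤ.+-identityʳ _)

⊕-⊗-isCommutativeSemiring : IsCommutativeSemiring _≗_ _⊕_ _⊗_ 0ₛ 1ₛ
⊕-⊗-isCommutativeSemiring = record
  { isSemiring = record
    { isSemiringWithoutAnnihilatingZero = record
      { +-isCommutativeMonoid = record
        { isMonoid = record
          { isSemigroup = record
            { isMagma = record
              { isEquivalence = record
                { refl  = λ _ → refl
                ; sym   = λ f≗g n → sym (f≗g n)
                ; trans = λ f≗g g≗h n → trans (f≗g n) (g≗h n)
                }
              ; ∙-cong = λ f≗ g≗ n → cong₂ ℤ._+_ (f≗ n) (g≗ n)
              }
            ; assoc = λ f g h n → ℤ.+-assoc (f n) (g n) (h n)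
            }
          ; identity = (λ f n → ℤ.+-identityˡ (f n)) , (λ f n → ℤ.+-identityʳ (f n))
          }
        ; comm = λ f g n → ℤ.+-comm (f n) (g n)
        }
      ; *-cong     = ⊗-cong
      ; *-assoc    = ⊗-assoc
      ; *-identity = 1-⊗ , λ f n → trans (⊗-comm f 1ₛ n) (1-⊗ f n)
      ; distrib    = (λ h f g n → trans (⊗-comm h (f ⊕ g) n)
                        (trans (⊗-distribʳ h f g n)
                               (cong₂ ℤ._+_ (⊗-comm f h n) (⊗-comm g h n))))
                   , ⊗-distribʳ
      }
    ; zero = 0-⊗ , λ f n → trans (⊗-comm f 0ₛ n) (0-⊗ f n)
    }
  ; *-comm = ⊗-comm
  }

seriesSemiring : CommutativeSemiring 0ℓ 0ℓ
seriesSemiring = record { isCommutativeSemiring = ⊕-⊗-isCommutativeSemiring }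

open CommutativeSemiring seriesSemiring using (setoid)
  renaming (refl to ≗-refl; sym to ≗-sym; trans to ≗-trans)
open import Algebra.Solver.Ring.NaturalCoefficients.Default seriesSemiring
  using (solve; _:+_; _:*_; _:=_; con)
import Relation.Binary.Reasoning.Setoid setoid as ≗-Reasoning

⊕-cong : ∀ {f f′ g g′} → f ≗ f′ → g ≗ g′ → f ⊕ g ≗ f′ ⊕ g′
⊕-cong f≗ g≗ n = cong₂ ℤ._+_ (f≗ n) (g≗ n)

⊗-congˡ : ∀ h {f g} → f ≗ g → h ⊗ f ≗ h ⊗ g
⊗-congˡ h = ⊗-cong {h} (λ _ → refl)

⊗-congʳ : ∀ h {f g} → f ≗ g → f ⊗ h ≗ g ⊗ h
⊗-congʳ h f≗g = ⊗-cong f≗g (λ _ → refl)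

⊗-0 : ∀ f → f ⊗ 0ₛ ≗ 0ₛ
⊗-0 f n = trans (⊗-comm f 0ₛ n) (0-⊗ f n)

⊗-1 : ∀ f → f ⊗ 1ₛ ≗ f
⊗-1 f n = trans (⊗-comm f 1ₛ n) (1-⊗ f n)

q^-+ : ∀ a b → q^ (a + b) ≗ q^ a ⊗ q^ b
q^-+ zero    b n       = sym (1-⊗ (q^ b) n)
q^-+ (suc a) b zero    = refl
q^-+ (suc a) b (suc n) = trans (q^-+ a b n) (sym (ℤ.+-identityˡ _))

≡⇒≗ : ∀ {f g : Series} → f ≡ g → f ≗ g
≡⇒≗ refl _ = refl

-- Comparing coefficients forces `h 0 ≡ g 0` and then `tail h ⊗ f ≗ remainder g f`, so any quotient
-- follows the steps of long division. Evaluating `qBinomial` thus reduces to a product identity.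
⊘-unique : ∀ h f g → f 0 ≡ 1ℤ → h ⊗ f ≗ g → h ≗ g ⊘ f
⊘-unique h f g f₀≡1 h⊗f≗g = go
  where
  h₀≡g₀ : h 0 ≡ g 0
  h₀≡g₀ = trans (lemma (h 0)) (trans (cong (λ z → h 0 * z ℤ.+ 0ℤ) (sym f₀≡1)) (h⊗f≗g 0))
    where
    lemma : ∀ a → a ≡ a * 1ℤ ℤ.+ 0ℤ
    lemma = solve-∀
  go : h ≗ g ⊘ f
  go zero    = h₀≡g₀
  go (suc n) = ⊘-unique (tail h) f (remainder g f) f₀≡1 tail-⊗ n
    where
    lemma : ∀ a b → b ≡ (a ℤ.+ b) ℤ.- a
    lemma = solve-∀
    tail-⊗ : tail h ⊗ f ≗ remainder g f
    tail-⊗ k = trans (lemma (h 0 * f (suc k)) ((tail h ⊗ f) k))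
                     (cong₂ ℤ._-_ (h⊗f≗g (suc k)) (cong (_* f (suc k)) h₀≡g₀))

⊗-·-comm : ∀ c f g → f ⊗ (c · g) ≗ c · (f ⊗ g)
⊗-·-comm c f g n = trans (⊗-comm f (c · g) n)
  (trans (·-⊗ c g f n) (cong (c *_) (⊗-comm g f n)))

-- Finite sums of series

module _ {a} {A : Set a} where

  ∑-cong : ∀ (xs : List A) {f g : A → Series} → (∀ {x} → x ∈ xs → f x ≗ g x) → ∑ xs f ≗ ∑ xs g
  ∑-cong []       f≗g _ = refl
  ∑-cong (x ∷ xs) f≗g   = ⊕-cong (f≗g (here refl)) (∑-cong xs (f≗g ∘ there))

  ∑-zero : ∀ (xs : List A) {f : A → Series} → (∀ {x} → x ∈ xs → f x ≗ 0ₛ) → ∑ xs f ≗ 0ₛ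
  ∑-zero []       f≗0 _ = refl
  ∑-zero (x ∷ xs) f≗0   = ⊕-cong (f≗0 (here refl)) (∑-zero xs (f≗0 ∘ there))

  ∑-⊕ : ∀ (xs : List A) (f g : A → Series) → (∑[ x ∈ xs ] f x ⊕ g x) ≗ ∑ xs f ⊕ ∑ xs g
  ∑-⊕ []       f g _ = refl
  ∑-⊕ (x ∷ xs) f g n =
    trans (cong (λ z → f x n ℤ.+ g x n ℤ.+ z) (∑-⊕ xs f g n))
          (lemma (f x n) (g x n) (∑ xs f n) (∑ xs g n))
    where
    lemma : ∀ a b c d → (a ℤ.+ b) ℤ.+ (c ℤ.+ d) ≡ (a ℤ.+ c) ℤ.+ (b ℤ.+ d)
    lemma = solve-∀

  ∑-⊗ : ∀ h (xs : List A) (f : A → Series) → (∑[ x ∈ xs ] h ⊗ f x) ≗ h ⊗ ∑ xs f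
  ∑-⊗ h []       f = ≗-sym (⊗-0 h)
  ∑-⊗ h (x ∷ xs) f = ≗-trans (⊕-cong (≗-refl {h ⊗ f x}) (∑-⊗ h xs f))
    (solve 3 (λ h x y → h :* x :+ h :* y := h :* (x :+ y)) (λ _ → refl) h (f x) (∑ xs f))

  ∑-++ : ∀ (xs ys : List A) (f : A → Series) → ∑ (xs ++ ys) f ≗ ∑ xs f ⊕ ∑ ys f
  ∑-++ []       ys f n = sym (ℤ.+-identityˡ _)
  ∑-++ (x ∷ xs) ys f n =
    trans (cong (λ z → f x n ℤ.+ z) (∑-++ xs ys f n)) (sym (ℤ.+-assoc (f x n) (∑ xs f n) (∑ ys f n)))

∑-map : ∀ {a b} {A : Set a} {B : Set b} (g : A → B) (xs : List A) (f : B → Series) →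
        ∑ (map g xs) f ≡ ∑ xs (f ∘ g)
∑-map g xs f = cong (foldr _⊕_ 0ₛ) (sym (map-∘ xs))

∑-↭ : ∀ {a} {A : Set a} {xs ys : List A} (f : A → Series) → xs ↭ ys → ∑ xs f ≗ ∑ ys f
∑-↭ f ↭.refl         _ = refl
∑-↭ f (↭.prep x p)   n = cong (λ z → f x n ℤ.+ z) (∑-↭ f p n)
∑-↭ f (↭.swap {xs} {ys} x y p) n = trans (cong (λ z → f x n ℤ.+ (f y n ℤ.+ z)) (∑-↭ f p n))
  (lemma (f x n) (f y n) (∑ ys f n))
  where
  lemma : ∀ a b c → a ℤ.+ (b ℤ.+ c) ≡ b ℤ.+ (a ℤ.+ c)
  lemma = solve-∀
∑-↭ f (↭.trans p q)  n = trans (∑-↭ f p n) (∑-↭ f q n)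

∑-applyUpTo : ∀ (f : ℕ → ℕ) n (h : ℕ → Series) → ∑ (applyUpTo f n) h ≡ ∑ (upTo n) (h ∘ f)
∑-applyUpTo f n h =
  cong (foldr _⊕_ 0ₛ) (trans (map-applyUpTo f h n) (sym (map-applyUpTo id (h ∘ f) n)))

∑-upTo-suc : ∀ n (h : ℕ → Series) → ∑ (upTo (suc n)) h ≗ h 0 ⊕ ∑ (upTo n) (h ∘ suc)
∑-upTo-suc n h = ⊕-cong (≗-refl {h 0}) (≡⇒≗ (∑-applyUpTo suc n h))

-- The induction works with sums from 0, while the theorem sums from `r`; the binomial coefficient
-- kills the terms in between.
∑-upTo-drop : ∀ r n (h : ℕ → Series) → (∀ {j} → j < r → h j ≗ 0ₛ) → r ≤ n →
              ∑ (upTo n) h ≗ ∑ (applyUpTo (r ℕ.+_) (n ∸ r)) h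
∑-upTo-drop zero    n       h h≗0 _         = ≗-refl {∑ (upTo n) h}
∑-upTo-drop (suc r) (suc n) h h≗0 (s≤s r≤n) = begin
  ∑ (upTo (suc n)) h
    ≈⟨ ∑-upTo-suc n h ⟩
  h 0 ⊕ ∑ (upTo n) (h ∘ suc)
    ≈⟨ ⊕-cong (h≗0 (s≤s z≤n)) (∑-upTo-drop r n (h ∘ suc) (h≗0 ∘ s≤s) r≤n) ⟩
  0ₛ ⊕ ∑ (applyUpTo (r ℕ.+_) (n ∸ r)) (h ∘ suc)
    ≈⟨ (λ _ → ℤ.+-identityˡ _) ⟩
  ∑ (applyUpTo (r ℕ.+_) (n ∸ r)) (h ∘ suc)
    ≡⟨ ∑-applyUpTo (r ℕ.+_) (n ∸ r) (h ∘ suc) ⟩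
  ∑ (upTo (n ∸ r)) (h ∘ (suc r ℕ.+_))
    ≡⟨ ∑-applyUpTo (suc r ℕ.+_) (n ∸ r) h ⟨
  ∑ (applyUpTo (suc r ℕ.+_) (n ∸ r)) h ∎
  where open ≗-Reasoning

-- Multiplication by the variable, when a family of series is read as the coefficients of a
-- polynomial: in t for the number of part sizes, in t - 1 for the number of marks.
shift : (ℕ → Series) → ℕ → Series
shift f zero    = 0ₛ
shift f (suc r) = f r

∑-shift : ∀ {a} {A : Set a} (xs : List A) (f : ℕ → A → Series) r →
          (∑[ x ∈ xs ] shift (λ s → f s x) r) ≗ shift (λ s → ∑ xs (f s)) r
∑-shift xs f zero    = ∑-zero xs (λ _ _ → refl)
∑-shift xs f (suc r) = ≗-refl {∑ xs (f r)}

-- q-binomial coefficients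

-- The q-binomial coefficient by one of the q-Pascal rules, without division. It vanishes for
-- `k > n`, which frees the recurrences below from side conditions.
gauss : ℕ → ℕ → Series
gauss n       zero    = 1ₛ
gauss zero    (suc k) = 0ₛ
gauss (suc n) (suc k) = gauss n k ⊕ q^ suc k ⊗ gauss n (suc k)

n<k⇒gauss≗0 : ∀ {n k} → n < k → gauss n k ≗ 0ₛ
n<k⇒gauss≗0 {zero}  {suc k} _         _ = refl
n<k⇒gauss≗0 {suc n} {suc k} (s≤s n<k) =
  ⊕-cong (n<k⇒gauss≗0 n<k)
    (≗-trans (⊗-congˡ (q^ suc k) (n<k⇒gauss≗0 (ℕ.m<n⇒m<1+n n<k))) (⊗-0 (q^ suc k)))

gauss-diag : ∀ n → gauss n n ≗ 1ₛ
gauss-diag zero    = ≗-refl {1ₛ}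
gauss-diag (suc n) i = trans
  (⊕-cong (gauss-diag n)
    (≗-trans (⊗-congˡ (q^ suc n) (n<k⇒gauss≗0 (ℕ.n<1+n n))) (⊗-0 (q^ suc n))) i)
  (ℤ.+-identityʳ _)

-- The exponents to be compared contain truncated subtractions and agree only for `k ≤ n`; for
-- larger `k` both sides vanish with `gauss n k`.
q^-gauss-cong : ∀ n k a b c d → (k ≤ n → a + b ≡ c + d) →
                q^ a ⊗ (q^ b ⊗ gauss n k) ≗ q^ c ⊗ (q^ d ⊗ gauss n k)
q^-gauss-cong n k a b c d eq with k ℕ.≤? n
... | yes k≤n = begin
  q^ a ⊗ (q^ b ⊗ gauss n k)  ≈⟨ ⊗-assoc (q^ a) (q^ b) (gauss n k) ⟨
  q^ a ⊗ q^ b ⊗ gauss n k    ≈⟨ ⊗-congʳ (gauss n k) (q^-+ a b) ⟨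
  q^ (a + b) ⊗ gauss n k     ≡⟨ cong (λ m → q^ m ⊗ gauss n k) (eq k≤n) ⟩
  q^ (c + d) ⊗ gauss n k     ≈⟨ ⊗-congʳ (gauss n k) (q^-+ c d) ⟩
  q^ c ⊗ q^ d ⊗ gauss n k    ≈⟨ ⊗-assoc (q^ c) (q^ d) (gauss n k) ⟩
  q^ c ⊗ (q^ d ⊗ gauss n k)  ∎
  where open ≗-Reasoning
... | no k≰n = ≗-trans (vanish a b) (≗-sym (vanish c d))
  where
  vanish : ∀ a b → q^ a ⊗ (q^ b ⊗ gauss n k) ≗ 0ₛ
  vanish a b = ≗-trans
    (⊗-congˡ (q^ a) (≗-trans (⊗-congˡ (q^ b) (n<k⇒gauss≗0 (ℕ.≰⇒> k≰n))) (⊗-0 (q^ b))))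
    (⊗-0 (q^ a))

-- The other q-Pascal rule. Both coefficients given by the defining rule are expanded by induction
-- and regrouped by the defining rule; what remains is q^(k+2) q^(n-k-1) = q^(n-k) q^(k+1).
gauss-pascal : ∀ n k → gauss (suc n) (suc k) ≗ gauss n (suc k) ⊕ q^ (n ∸ k) ⊗ gauss n k
gauss-pascal zero zero =
  solve 1 (λ q → con 1 :+ q :* con 0 := con 0 :+ con 1 :* con 1) (λ _ → refl) (q^ 1)
gauss-pascal zero (suc k) =
  solve 1 (λ q → con 0 :+ q :* con 0 := con 0 :+ con 1 :* con 0) (λ _ → refl) (q^ suc (suc k))
gauss-pascal (suc n) zero = begin
  1ₛ ⊕ q^ 1 ⊗ gauss (suc n) 1
    ≈⟨ ⊕-cong (≗-refl {1ₛ}) (⊗-congˡ (q^ 1) (gauss-pascal n zero)) ⟩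
  1ₛ ⊕ q^ 1 ⊗ (gauss n 1 ⊕ q^ n ⊗ 1ₛ)
    ≈⟨ solve 3 (λ q g p → con 1 :+ q :* (g :+ p :* con 1) := con 1 :+ q :* g :+ q :* p :* con 1)
         (λ _ → refl) (q^ 1) (gauss n 1) (q^ n) ⟩
  gauss (suc n) 1 ⊕ q^ 1 ⊗ q^ n ⊗ 1ₛ
    ≈⟨ ⊕-cong (≗-refl {gauss (suc n) 1}) (⊗-congʳ 1ₛ (q^-+ 1 n)) ⟨
  gauss (suc n) 1 ⊕ q^ suc n ⊗ 1ₛ ∎
  where open ≗-Reasoning
gauss-pascal (suc n) (suc k) = begin
  gauss (suc n) (suc k) ⊕ q^ (2 + k) ⊗ gauss (suc n) (2 + k)
    ≈⟨ ⊕-cong (gauss-pascal n k) (⊗-congˡ (q^ (2 + k)) (gauss-pascal n (suc k))) ⟩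
  (gauss n (suc k) ⊕ q^ (n ∸ k) ⊗ gauss n k)
    ⊕ q^ (2 + k) ⊗ (gauss n (2 + k) ⊕ q^ (n ∸ suc k) ⊗ gauss n (suc k))
    ≈⟨ solve 6 (λ x p y r z t → (x :+ p :* y) :+ r :* (z :+ t :* x) :=
                                (x :+ p :* y) :+ r :* z :+ r :* (t :* x)) (λ _ → refl)
         (gauss n (suc k)) (q^ (n ∸ k)) (gauss n k)
         (q^ (2 + k)) (gauss n (2 + k)) (q^ (n ∸ suc k)) ⟩
  (gauss n (suc k) ⊕ q^ (n ∸ k) ⊗ gauss n k) ⊕ q^ (2 + k) ⊗ gauss n (2 + k)
    ⊕ q^ (2 + k) ⊗ (q^ (n ∸ suc k) ⊗ gauss n (suc k))
    ≈⟨ ⊕-cong (≗-refl {(gauss n (suc k) ⊕ q^ (n ∸ k) ⊗ gauss n k) ⊕ q^ (2 + k) ⊗ gauss n (2 + k)})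
              (q^-gauss-cong n (suc k) (2 + k) (n ∸ suc k) (n ∸ k) (suc k) exponents) ⟩
  (gauss n (suc k) ⊕ q^ (n ∸ k) ⊗ gauss n k) ⊕ q^ (2 + k) ⊗ gauss n (2 + k)
    ⊕ q^ (n ∸ k) ⊗ (q^ suc k ⊗ gauss n (suc k))
    ≈⟨ solve 6 (λ x p y r z t → (x :+ p :* y) :+ r :* z :+ p :* (t :* x) :=
                                (x :+ r :* z) :+ p :* (y :+ t :* x)) (λ _ → refl)
         (gauss n (suc k)) (q^ (n ∸ k)) (gauss n k)
         (q^ (2 + k)) (gauss n (2 + k)) (q^ suc k) ⟩
  gauss (suc n) (2 + k) ⊕ q^ (n ∸ k) ⊗ gauss (suc n) (suc k) ∎
  where
  open ≗-Reasoning
  exponents : suc k ≤ n → 2 + k + (n ∸ suc k) ≡ n ∸ k + suc k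
  exponents k<n = trans (cong suc (ℕ.m+[n∸m]≡n k<n)) (trans
    (cong suc (sym (ℕ.m∸n+n≡m (ℕ.<⇒≤ k<n)))) (sym (ℕ.+-suc (n ∸ k) k)))

⊖-⊕-cancel : ∀ f g → (f ⊖ g) ⊕ g ≗ f
⊖-⊕-cancel f g n = lemma (f n) (g n)
  where
  lemma : ∀ x y → x ℤ.- y ℤ.+ y ≡ x
  lemma = solve-∀

⊕≗⇒≗⊖ : ∀ f g h → f ⊕ g ≗ h → f ≗ h ⊖ g
⊕≗⇒≗⊖ f g h f⊕g≗h n = trans (lemma (f n) (g n)) (cong (ℤ._- g n) (f⊕g≗h n))
  where
  lemma : ∀ x y → x ≡ x ℤ.+ y ℤ.- y
  lemma = solve-∀

q-telescope : ∀ a b → (1ₛ ⊖ q^ b) ⊕ q^ b ⊗ (1ₛ ⊖ q^ a) ≗ 1ₛ ⊖ q^ (a + b)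
-- Adding `q^ (a + b)` to both sides removes the outer subtraction; `⊖-⊕-cancel` then absorbs the
-- two differences on the left.
q-telescope a b = ⊕≗⇒≗⊖ ((1ₛ ⊖ q^ b) ⊕ q^ b ⊗ (1ₛ ⊖ q^ a)) (q^ (a + b)) 1ₛ (begin
  (1ₛ ⊖ q^ b) ⊕ q^ b ⊗ (1ₛ ⊖ q^ a) ⊕ q^ (a + b)
    ≈⟨ ⊕-cong (≗-refl {(1ₛ ⊖ q^ b) ⊕ q^ b ⊗ (1ₛ ⊖ q^ a)}) (q^-+ a b) ⟩
  (1ₛ ⊖ q^ b) ⊕ q^ b ⊗ (1ₛ ⊖ q^ a) ⊕ q^ a ⊗ q^ b
    ≈⟨ solve 4 (λ x y z w → x :+ y :* z :+ w :* y := x :+ y :* (z :+ w)) (λ _ → refl)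
         (1ₛ ⊖ q^ b) (q^ b) (1ₛ ⊖ q^ a) (q^ a) ⟩
  (1ₛ ⊖ q^ b) ⊕ q^ b ⊗ ((1ₛ ⊖ q^ a) ⊕ q^ a)
    ≈⟨ ⊕-cong (≗-refl {1ₛ ⊖ q^ b})
         (≗-trans (⊗-congˡ (q^ b) (⊖-⊕-cancel 1ₛ (q^ a))) (⊗-1 (q^ b))) ⟩
  (1ₛ ⊖ q^ b) ⊕ q^ b
    ≈⟨ ⊖-⊕-cancel 1ₛ (q^ b) ⟩
  1ₛ ∎)
  where open ≗-Reasoning

-- For positive `a` and `k` the two terms of the defining q-Pascal rule contribute (q)_(a+k-1) times
-- 1 - q^k and q^k (1 - q^a), which add up to 1 - q^(a+k). Using `a` for n - k avoids truncated
-- subtraction.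
gauss-⦅q⦆ : ∀ a k → gauss (a + k) k ⊗ (⦅q⦆ a ⊗ ⦅q⦆ k) ≗ ⦅q⦆ (a + k)
gauss-⦅q⦆ a zero rewrite ℕ.+-identityʳ a = ≗-trans (1-⊗ (⦅q⦆ a ⊗ 1ₛ)) (⊗-1 (⦅q⦆ a))
gauss-⦅q⦆ zero k@(suc _) =
  ≗-trans (⊗-cong (gauss-diag k) (1-⊗ (⦅q⦆ k))) (1-⊗ (⦅q⦆ k))
gauss-⦅q⦆ (suc a) (suc k) = begin
  (X ⊕ q^ suc k ⊗ Y) ⊗ (⦅q⦆ a ⊗ A′ ⊗ (⦅q⦆ k ⊗ B′))
    ≈⟨ solve 7 (λ x q y p a r b → (x :+ q :* y) :* (p :* a :* (r :* b)) :=
                 x :* (p :* a :* r) :* b :+ y :* (p :* (r :* b)) :* (q :* a)) (λ _ → refl)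
         X (q^ suc k) Y (⦅q⦆ a) A′ (⦅q⦆ k) B′ ⟩
  X ⊗ (⦅q⦆ (suc a) ⊗ ⦅q⦆ k) ⊗ B′ ⊕ Y ⊗ (⦅q⦆ a ⊗ ⦅q⦆ (suc k)) ⊗ (q^ suc k ⊗ A′)
    ≈⟨ ⊕-cong (⊗-congʳ B′ X-⦅q⦆) (⊗-congʳ (q^ suc k ⊗ A′) (gauss-⦅q⦆ a (suc k))) ⟩
  F ⊗ B′ ⊕ F ⊗ (q^ suc k ⊗ A′)
    ≈⟨ solve 3 (λ f b c → f :* b :+ f :* c := f :* (b :+ c)) (λ _ → refl) F B′ (q^ suc k ⊗ A′) ⟩
  F ⊗ (B′ ⊕ q^ suc k ⊗ A′)
    ≈⟨ ⊗-congˡ F (q-telescope (suc a) (suc k)) ⟩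
  F ⊗ (1ₛ ⊖ q^ (suc a + suc k)) ∎
  where
  open ≗-Reasoning
  A′ B′ X Y F : Series
  A′ = 1ₛ ⊖ q^ suc a
  B′ = 1ₛ ⊖ q^ suc k
  X = gauss (a + suc k) k
  Y = gauss (a + suc k) (suc k)
  F = ⦅q⦆ (a + suc k)
  X-⦅q⦆ : X ⊗ (⦅q⦆ (suc a) ⊗ ⦅q⦆ k) ≗ F
  X-⦅q⦆ rewrite ℕ.+-suc a k = gauss-⦅q⦆ (suc a) k

qBinomial≗gauss : ∀ a k → qBinomial (a + k) k ≗ gauss (a + k) k
qBinomial≗gauss a k rewrite ℕ.m+n∸n≡m a k =
  ≗-sym (⊘-unique (gauss (a + k) k) (⦅q⦆ a ⊗ ⦅q⦆ k) (⦅q⦆ (a + k))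
    (⦅q⦆⊗⦅q⦆₀≡1 a k) (gauss-⦅q⦆ a k))

-- The denominator is symmetric in `a` and `k`, so the same quotient equals the coefficient with the
-- complementary lower index, the form that `markedGF` uses.
qBinomial≗gaussᶜ : ∀ a k → qBinomial (a + k) k ≗ gauss (a + k) a
qBinomial≗gaussᶜ a k rewrite ℕ.m+n∸n≡m a k | ℕ.+-comm a k =
  ≗-sym (⊘-unique (gauss (k + a) a) (⦅q⦆ a ⊗ ⦅q⦆ k) (⦅q⦆ (k + a)) (⦅q⦆⊗⦅q⦆₀≡1 a k)
    (≗-trans (⊗-congˡ (gauss (k + a) a) (⊗-comm (⦅q⦆ a) (⦅q⦆ k))) (gauss-⦅q⦆ k a)))

-- Partitions with marked part sizes

-- The lower index M, in place of the N ∸ k of the theorem, makes this vanish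
-- for k > M ⊓ N.
markedGF : ℕ → ℕ → ℕ → Series
markedGF M N k = q^ (suc k C 2) ⊗ gauss M k ⊗ gauss (M + N ∸ k) M

-- The binomial coefficient grows by k + 1 from one index to the next, and k + (M - k) = M. This
-- pulls q^(M+1) out of the second term of `gauss-pascal` in `markedGF-step`.
triangular-shift : ∀ M k → k ≤ M → suc (suc k) C 2 + (M ∸ k) ≡ suc M + suc k C 2
triangular-shift M k k≤M = begin
  suc (suc k) C 2 + (M ∸ k)      ≡⟨ cong (λ t → t + (M ∸ k)) (nCk+nC[k+1]≡[n+1]C[k+1] (suc k) 1) ⟨
  suc k C 1 + suc k C 2 + (M ∸ k)  ≡⟨ cong (λ t → t + suc k C 2 + (M ∸ k)) (nC1≡n (suc k)) ⟩
  suc k + suc k C 2 + (M ∸ k)    ≡⟨ cong (λ t → t + (M ∸ k)) (ℕ.+-comm (suc k) (suc k C 2)) ⟩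
  suc k C 2 + suc k + (M ∸ k)    ≡⟨ ℕ.+-assoc (suc k C 2) (suc k) (M ∸ k) ⟩
  suc k C 2 + suc (k + (M ∸ k))  ≡⟨ cong (λ m → suc k C 2 + suc m) (ℕ.m+[n∸m]≡n k≤M) ⟩
  suc k C 2 + suc M              ≡⟨ ℕ.+-comm (suc k C 2) (suc M) ⟩
  suc M + suc k C 2              ∎
  where open ≡-Reasoning

markedGF-zero : ∀ M N k → M ⊓ N ≡ 0 → markedGF M N (suc k) ≗ 0ₛ
markedGF-zero zero    N    k _ =
  solve 1 (λ x → x :* con 0 :* con 1 := con 0) (λ _ → refl) (q^ (suc (suc k) C 2))
markedGF-zero (suc M) zero k _ =
  -- `gauss (suc M) (suc k)` need not vanish here; the other coefficient does, since its lower index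
  -- `suc M` exceeds its upper index.
  ≗-trans (⊗-congˡ X (n<k⇒gauss≗0 bound)) (⊗-0 X)
  where
  X : Series
  X = q^ (suc (suc k) C 2) ⊗ gauss (suc M) (suc k)
  bound : M + 0 ∸ k < suc M
  bound = s≤s (ℕ.≤-trans (ℕ.m∸n≤m (M + 0) k) (ℕ.≤-reflexive (ℕ.+-identityʳ M)))

markedGF-one : ∀ M N → M ⊓ N ≡ 0 → markedGF M N 0 ≗ 1ₛ
markedGF-one zero    N    _ = solve 0 (con 1 :* con 1 :* con 1 := con 1) (λ _ → refl)
markedGF-one (suc M) zero _ rewrite ℕ.+-identityʳ M =
  ≗-trans (⊗-cong (1-⊗ 1ₛ) (gauss-diag (suc M))) (1-⊗ 1ₛ)

-- The defining q-Pascal rule splits the second coefficient, and `gauss-pascal` splits the first in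
-- one of the resulting terms. Combinatorially: the size M + 1 does not occur, or a copy of it
-- remains after one copy of each marked size is removed, or its only copy is marked.
markedGF-step : ∀ M N k → markedGF (suc M) (suc N) k ≗
  markedGF M (suc N) k ⊕ q^ suc M ⊗ (markedGF (suc M) N k ⊕ shift (markedGF M N) k)
markedGF-step M N zero rewrite ℕ.+-suc M N =
  solve 3 (λ x p y → con 1 :* con 1 :* (x :+ p :* y) :=
                     con 1 :* con 1 :* x :+ p :* (con 1 :* con 1 :* y :+ con 0)) (λ _ → refl)
    (gauss (suc (M + N)) M) (q^ suc M) (gauss (suc (M + N)) (suc M))
markedGF-step M N (suc k) rewrite ℕ.+-suc M N = begin
  T′ ⊗ U ⊗ gauss (suc (M + N) ∸ k) (suc M)
    ≈⟨ clip ⟩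
  T′ ⊗ U ⊗ (X ⊕ p ⊗ Y)
    ≈⟨ solve 5 (λ t u x p y → t :* u :* (x :+ p :* y) := u :* (t :* x) :+ p :* (t :* u :* y))
         (λ _ → refl) T′ U X p Y ⟩
  U ⊗ (T′ ⊗ X) ⊕ p ⊗ (T′ ⊗ U ⊗ Y)
    ≈⟨ ⊕-cong (⊗-congʳ (T′ ⊗ X) (gauss-pascal M k)) (≗-refl {p ⊗ (T′ ⊗ U ⊗ Y)}) ⟩
  (V ⊕ q^ (M ∸ k) ⊗ W) ⊗ (T′ ⊗ X) ⊕ p ⊗ (T′ ⊗ U ⊗ Y)
    ≈⟨ solve 7 (λ v z w t x p a → (v :+ z :* w) :* (t :* x) :+ p :* a :=
                                  t :* v :* x :+ (p :* a :+ t :* (z :* w) :* x)) (λ _ → refl)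
         V (q^ (M ∸ k)) W T′ X p (T′ ⊗ U ⊗ Y) ⟩
  T′ ⊗ V ⊗ X ⊕ (p ⊗ (T′ ⊗ U ⊗ Y) ⊕ T′ ⊗ (q^ (M ∸ k) ⊗ W) ⊗ X)
    ≈⟨ ⊕-cong (≗-refl {T′ ⊗ V ⊗ X}) (⊕-cong (≗-refl {p ⊗ (T′ ⊗ U ⊗ Y)})
         (⊗-congʳ X (q^-gauss-cong M k (suc (suc k) C 2) (M ∸ k) (suc M) (suc k C 2)
                       (triangular-shift M k)))) ⟩
  T′ ⊗ V ⊗ X ⊕ (p ⊗ (T′ ⊗ U ⊗ Y) ⊕ p ⊗ (T ⊗ W) ⊗ X)
    ≈⟨ solve 6 (λ b p a t w x → b :+ (p :* a :+ p :* (t :* w) :* x) :=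
                                b :+ p :* (a :+ t :* w :* x))
         (λ _ → refl) (T′ ⊗ V ⊗ X) p (T′ ⊗ U ⊗ Y) T W X ⟩
  T′ ⊗ V ⊗ X ⊕ p ⊗ (T′ ⊗ U ⊗ Y ⊕ T ⊗ W ⊗ X) ∎
  where
  open ≗-Reasoning
  T T′ U V W X Y p : Series
  T  = q^ (suc k C 2)
  T′ = q^ (suc (suc k) C 2)
  U  = gauss (suc M) (suc k)
  V  = gauss M (suc k)
  W  = gauss M k
  X  = gauss (M + N ∸ k) M
  Y  = gauss (M + N ∸ k) (suc M)
  p  = q^ suc M
  -- The subtraction saturates only for some k > M, where U vanishes.
  clip : T′ ⊗ U ⊗ gauss (suc (M + N) ∸ k) (suc M) ≗ T′ ⊗ U ⊗ gauss (suc (M + N ∸ k)) (suc M)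
  clip with k ℕ.≤? M
  ... | yes k≤M = ≡⇒≗ (cong (λ m → T′ ⊗ U ⊗ gauss m (suc M))
                        (ℕ.+-∸-assoc 1 (ℕ.≤-trans k≤M (ℕ.m≤m+n M N))))
  ... | no  k≰M = ≗-trans (vanish (suc (M + N) ∸ k)) (≗-sym (vanish (suc (M + N ∸ k))))
    where
    vanish : ∀ m → T′ ⊗ U ⊗ gauss m (suc M) ≗ 0ₛ
    vanish m = ≗-trans (⊗-congʳ (gauss m (suc M))
      (≗-trans (⊗-congˡ T′ (n<k⇒gauss≗0 (s≤s (ℕ.≰⇒> k≰M)))) (⊗-0 T′))) (0-⊗ (gauss m (suc M)))

-- Inclusion–exclusion

-- The coefficient of t^r in (t - 1)^j.
signedC : ℕ → ℕ → ℤ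
signedC j r = (+ (j C r)) * (-1ℤ ^ (j ∸ r))

j<r⇒signedC≡0 : ∀ {j r} → j < r → signedC j r ≡ 0ℤ
j<r⇒signedC≡0 {j} {r} j<r = cong (λ m → + m * (-1ℤ ^ (j ∸ r))) (k>n⇒nCk≡0 j<r)

-- Together with `signedC-suc` this is (t - 1)^(j+1) + (t - 1)^j = t (t - 1)^j, coefficient by
-- coefficient.
signedC-zero : ∀ j → signedC (suc j) 0 ℤ.+ signedC j 0 ≡ 0ℤ
signedC-zero j = lemma (-1ℤ ^ j)
  where
  lemma : ∀ x → 1ℤ * (-1ℤ * x) ℤ.+ 1ℤ * x ≡ 0ℤ
  lemma = solve-∀

signedC-suc : ∀ j r → signedC (suc j) (suc r) ℤ.+ signedC j (suc r) ≡ signedC j r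
signedC-suc j r with r ℕ.<? j
... | yes r<j = begin
  + (suc j C suc r) * (-1ℤ ^ (j ∸ r)) ℤ.+ + (j C suc r) * s
    ≡⟨ cong₂ (λ m e → + m * (-1ℤ ^ e) ℤ.+ + (j C suc r) * s)
         (sym (nCk+nC[k+1]≡[n+1]C[k+1] j r)) (ℕ.+-∸-assoc 1 r<j) ⟩
  (+ (j C r) ℤ.+ + (j C suc r)) * (-1ℤ * s) ℤ.+ + (j C suc r) * s
    ≡⟨ lemma (+ (j C r)) (+ (j C suc r)) s ⟩
  + (j C r) * (-1ℤ * s)
    ≡⟨ cong (λ e → + (j C r) * (-1ℤ ^ e)) (ℕ.+-∸-assoc 1 r<j) ⟨
  + (j C r) * (-1ℤ ^ (j ∸ r)) ∎
  where
  open ≡-Reasoning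
  s : ℤ
  s = -1ℤ ^ (j ∸ suc r)
  lemma : ∀ x y s → (x ℤ.+ y) * (-1ℤ * s) ℤ.+ y * s ≡ x * (-1ℤ * s)
  lemma = solve-∀
-- The truncated exponents `j ∸ r` and `j ∸ suc r` no longer differ by one, but `j C suc r` is 0.
... | no r≮j = begin
  + (suc j C suc r) * (-1ℤ ^ (j ∸ r)) ℤ.+ signedC j (suc r)
    ≡⟨ cong₂ (λ m z → + m * (-1ℤ ^ (j ∸ r)) ℤ.+ z)
         (trans (sym (nCk+nC[k+1]≡[n+1]C[k+1] j r))
                (trans (cong (j C r ℕ.+_) (k>n⇒nCk≡0 j<1+r)) (ℕ.+-identityʳ _)))
         (j<r⇒signedC≡0 j<1+r) ⟩
  signedC j r ℤ.+ 0ℤ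
    ≡⟨ ℤ.+-identityʳ (signedC j r) ⟩
  signedC j r ∎
  where
  open ≡-Reasoning
  j<1+r : j < suc r
  j<1+r = s≤s (ℕ.≮⇒≥ r≮j)

sieveGF : ℕ → ℕ → ℕ → ℕ → Series
sieveGF K M N r = ∑[ j ∈ upTo (suc K) ] signedC j r · markedGF M N j

signedC-shift : ∀ n r (g : ℕ → Series) →
  (∑[ j ∈ upTo n ] signedC (suc j) r · g j) ⊕ (∑[ j ∈ upTo n ] signedC j r · g j) ≗
  shift (λ r → ∑[ j ∈ upTo n ] signedC j r · g j) r
signedC-shift n r g = ≗-trans
  (≗-sym (∑-⊕ (upTo n) (λ j → signedC (suc j) r · g j) (λ j → signedC j r · g j)))
  (combine r)
  where
  combine : ∀ r → (∑[ j ∈ upTo n ] (signedC (suc j) r · g j) ⊕ (signedC j r · g j)) ≗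
                  shift (λ r → ∑[ j ∈ upTo n ] signedC j r · g j) r
  combine zero    = ∑-zero (upTo n) λ {j} _ i →
    trans (sym (ℤ.*-distribʳ-+ (g j i) (signedC (suc j) 0) (signedC j 0)))
          (cong (_* g j i) (signedC-zero j))
  combine (suc r) = ∑-cong (upTo n) λ {j} _ i →
    trans (sym (ℤ.*-distribʳ-+ (g j i) (signedC (suc j) (suc r)) (signedC j (suc r))))
          (cong (_* g j i) (signedC-suc j r))

-- The last term of `markedGF-step` raises j by one and so brings in a factor t - 1. The q^(M+1)
-- multiple added on the left turns t - 1 into t, hence the `shift`, and keeps the recurrence free
-- of subtraction.
sieveGF-step : ∀ K M N r →
  sieveGF (suc K) (suc M) (suc N) r ⊕ q^ suc M ⊗ sieveGF K M N r ≗
  sieveGF (suc K) M (suc N) r ⊕ q^ suc M ⊗ (sieveGF (suc K) (suc M) N r ⊕ shift (sieveGF K M N) r)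
sieveGF-step K M N r = begin
  sieveGF (suc K) (suc M) (suc N) r ⊕ p ⊗ sieveGF K M N r
    ≈⟨ ⊕-cong expand (≗-refl {p ⊗ sieveGF K M N r}) ⟩
  A′ ⊕ p ⊗ (B′ ⊕ D) ⊕ p ⊗ sieveGF K M N r
    ≈⟨ solve 5 (λ a p b d s → a :+ p :* (b :+ d) :+ p :* s := a :+ p :* (b :+ (d :+ s))) (λ _ → refl)
         A′ p B′ D (sieveGF K M N r) ⟩
  A′ ⊕ p ⊗ (B′ ⊕ (D ⊕ sieveGF K M N r))
    ≈⟨ ⊕-cong (≗-refl {A′}) (⊗-congˡ p (⊕-cong (≗-refl {B′}) D-shift)) ⟩
  A′ ⊕ p ⊗ (B′ ⊕ shift (sieveGF K M N) r) ∎
  where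
  open ≗-Reasoning
  p A′ B′ D : Series
  p  = q^ suc M
  A′ = sieveGF (suc K) M (suc N) r
  B′ = sieveGF (suc K) (suc M) N r
  D  = ∑[ j ∈ upTo (suc (suc K)) ] signedC j r · shift (markedGF M N) j
  js : List ℕ
  js = upTo (suc (suc K))
  c·-step : ∀ c x y z → c · (x ⊕ p ⊗ (y ⊕ z)) ≗ c · x ⊕ p ⊗ (c · y ⊕ c · z)
  c·-step c x y z = ≗-trans
    (λ i → ℤ.*-distribˡ-+ c (x i) ((p ⊗ (y ⊕ z)) i))
    (⊕-cong (≗-refl {c · x}) (≗-trans (≗-sym (⊗-·-comm c p (y ⊕ z)))
      (⊗-congˡ p (λ i → ℤ.*-distribˡ-+ c (y i) (z i)))))
  expand : sieveGF (suc K) (suc M) (suc N) r ≗ A′ ⊕ p ⊗ (B′ ⊕ D)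
  expand = begin
    sieveGF (suc K) (suc M) (suc N) r
      ≈⟨ ∑-cong js (λ {j} _ → ≗-trans
           (λ i → cong (signedC j r *_) (markedGF-step M N j i))
           (c·-step (signedC j r) (markedGF M (suc N) j) (markedGF (suc M) N j)
                    (shift (markedGF M N) j))) ⟩
    (∑[ j ∈ js ] (a j ⊕ p ⊗ (b j ⊕ d j)))
      ≈⟨ ∑-⊕ js a (λ j → p ⊗ (b j ⊕ d j)) ⟩
    A′ ⊕ (∑[ j ∈ js ] p ⊗ (b j ⊕ d j))
      ≈⟨ ⊕-cong (≗-refl {A′}) (≗-trans (∑-⊗ p js (λ j → b j ⊕ d j)) (⊗-congˡ p (∑-⊕ js b d))) ⟩
    A′ ⊕ p ⊗ (B′ ⊕ D) ∎
    where
    a b d : ℕ → Series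
    a j = signedC j r · markedGF M (suc N) j
    b j = signedC j r · markedGF (suc M) N j
    d j = signedC j r · shift (markedGF M N) j
  E : Series
  E = ∑[ j ∈ upTo (suc K) ] signedC (suc j) r · markedGF M N j
  -- The shifted term is 0 at j = 0. Reindexing the others shortens the range by one, which is why
  -- `K` appears in place of `suc K`.
  D≗E : D ≗ E
  D≗E i = trans (∑-upTo-suc (suc K) (λ j → signedC j r · shift (markedGF M N) j) i)
    (trans (cong (λ z → z ℤ.+ E i) (ℤ.*-zeroʳ (signedC 0 r))) (ℤ.+-identityˡ (E i)))
  D-shift : D ⊕ sieveGF K M N r ≗ shift (sieveGF K M N) r
  D-shift = ≗-trans (⊕-cong D≗E (≗-refl {sieveGF K M N r})) (signedC-shift (suc K) r (markedGF M N))

-- No part size can be marked in an empty box, so only j = 0 contributes.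
sieveGF-degenerate : ∀ K M N r → M ⊓ N ≡ 0 → sieveGF K M N r ≗ signedC 0 r · 1ₛ
sieveGF-degenerate K M N r M⊓N≡0 i = trans
  (∑-upTo-suc K (λ j → signedC j r · markedGF M N j) i)
  (trans (cong₂ ℤ._+_ (cong (signedC 0 r *_) (markedGF-one M N M⊓N≡0 i))
           (∑-zero (upTo K) (λ {j} _ n →
             trans (cong (signedC (suc j) r *_) (markedGF-zero M N j M⊓N≡0 n))
                   (ℤ.*-zeroʳ (signedC (suc j) r))) i))
         (ℤ.+-identityʳ _))

-- Enumerating the partitions in a box

distinctPartSizes-new : ∀ {x xs} → All (x ≢_) xs →
                        distinctPartSizes (x ∷ xs) ≡ suc (distinctPartSizes xs)
distinctPartSizes-new {x} ≢xs =
  cong (suc ∘ length) (filter-all (¬? ∘ (x ℕ.≟_)) (All.deduplicate⁺ ℕ._≟_ ≢xs))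

distinctPartSizes-old : ∀ x xs → distinctPartSizes (x ∷ x ∷ xs) ≡ distinctPartSizes (x ∷ xs)
distinctPartSizes-old x xs = cong (suc ∘ length) (trans
  (filter-reject (¬? ∘ (x ℕ.≟_)) {xs = filter (¬? ∘ (x ℕ.≟_)) (deduplicate ℕ._≟_ xs)}
    (λ x≢x → x≢x refl))
  (filter-idem (¬? ∘ (x ℕ.≟_)) (deduplicate ℕ._≟_ xs)))

infix 6 _when_≟_

_when_≟_ : Series → ℕ → ℕ → Series
f when d ≟ r = if does (d ℕ.≟ r) then f else 0ₛ

-- With the condition on `r` moved into the summand, the list summed over does not depend on `r` and
-- can be split by largest part.
weight : ℕ → List ℕ → Series
weight r λs = q^ sum λs when distinctPartSizes λs ≟ r

q^-+-when : ∀ m n d r → q^ (m + n) when d ≟ r ≗ q^ m ⊗ (q^ n when d ≟ r)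
q^-+-when m n d r with does (d ℕ.≟ r)
... | true  = q^-+ m n
... | false = ≗-sym (⊗-0 (q^ m))

-- A new part size contributes t q^x, whereas a repeated one, in `weight-old`, contributes only q^x.
-- The t - 1 of the recurrence is this difference.
weight-new : ∀ r {x xs} → All (x ≢_) xs → weight r (x ∷ xs) ≗ q^ x ⊗ shift (λ s → weight s xs) r
weight-new r {x} {xs} ≢xs = ≗-trans
  (≡⇒≗ (cong (λ d → q^ (x + sum xs) when d ≟ r) (distinctPartSizes-new ≢xs))) (shifted r)
  where
  shifted : ∀ r → q^ (x + sum xs) when suc (distinctPartSizes xs) ≟ r ≗
                  q^ x ⊗ shift (λ s → weight s xs) r
  shifted zero    = ≗-sym (⊗-0 (q^ x))
  shifted (suc r) = q^-+-when x (sum xs) (distinctPartSizes xs) r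

weight-old : ∀ r x xs → weight r (x ∷ x ∷ xs) ≗ q^ x ⊗ weight r (x ∷ xs)
weight-old r x xs = ≗-trans
  (≡⇒≗ (cong (λ d → q^ (x + sum (x ∷ xs)) when d ≟ r) (distinctPartSizes-old x xs)))
  (q^-+-when x (sum (x ∷ xs)) (distinctPartSizes (x ∷ xs)) r)

-- The enumeration branches on whether the largest allowed size occurs, which is the shape of the
-- recurrence.
partitions : ℕ → ℕ → List (List ℕ)
partitions M       zero    = [] ∷ []
partitions zero    (suc N) = [] ∷ []
partitions (suc M) (suc N) = partitions M (suc N) ++ map (suc M ∷_) (partitions (suc M) N)

IsPartitionInBox : ℕ → ℕ → List ℕ → Set
IsPartitionInBox M N λs = IsPartition λs × InBox M N λs

∈-partitions⁻ : ∀ M N {λs} → λs ∈ partitions M N → IsPartitionInBox M N λs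
∈-partitions⁻ M       zero    (here refl) = ([] , []) , (z≤n , [])
∈-partitions⁻ zero    (suc N) (here refl) = ([] , []) , (z≤n , [])
∈-partitions⁻ (suc M) (suc N) λs∈ with ∈-++⁻ (partitions M (suc N)) λs∈
... | inj₁ λs∈ˡ = let p , len , ≤M = ∈-partitions⁻ M (suc N) λs∈ˡ
                  in p , len , All.map ℕ.m≤n⇒m≤1+n ≤M
... | inj₂ λs∈ʳ with μs , μs∈ , refl ← ∈-map⁻ (suc M ∷_) λs∈ʳ
  = let (linked , pos) , len , ≤M = ∈-partitions⁻ (suc M) N μs∈
    in (link ≤M linked , s≤s z≤n ∷ pos) , s≤s len , ℕ.≤-refl ∷ ≤M
  where
  link : ∀ {x xs} → All (_≤ x) xs → Linked ℕ._≥_ xs → Linked ℕ._≥_ (x ∷ xs)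
  link []        []     = [-]
  link (y≤x ∷ _) linked = y≤x ∷ linked

[]∈partitions : ∀ M N → [] ∈ partitions M N
[]∈partitions M       zero    = here refl
[]∈partitions zero    (suc N) = here refl
[]∈partitions (suc M) (suc N) = ∈-++⁺ˡ ([]∈partitions M (suc N))

∈-partitions⁺ : ∀ M N {λs} → IsPartitionInBox M N λs → λs ∈ partitions M N
∈-partitions⁺ M N {[]} _ = []∈partitions M N
∈-partitions⁺ zero    (suc N) {x ∷ _}  ((_ , 0<x ∷ _) , _ , x≤0 ∷ _) =
  contradiction x≤0 (ℕ.<⇒≱ 0<x)
∈-partitions⁺ (suc M) (suc N) {x ∷ xs} ((linked , 0<x ∷ pos) , s≤s len , x≤1+M ∷ ≤M)
  with x ℕ.≟ suc M
... | yes refl = ∈-++⁺ʳ (partitions M (suc N))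
  (∈-map⁺ (suc M ∷_) (∈-partitions⁺ (suc M) N ((Linked.tail linked , pos) , len , ≤M)))
-- A first part other than `suc M` is at most `M`, and it bounds all later parts.
... | no x≢1+M = ∈-++⁺ˡ (∈-partitions⁺ M (suc N) ((linked , 0<x ∷ pos) , s≤s len ,
  Linked⇒All (λ i≥j j≥k → ℕ.≤-trans j≥k i≥j) (s≤s⁻¹ (ℕ.≤∧≢⇒< x≤1+M x≢1+M)) linked))

1+M∉partitions : ∀ M N {λs} → λs ∈ partitions M N → All (suc M ≢_) λs
1+M∉partitions M N λs∈ =
  All.map (λ x≤M 1+M≡x → ℕ.<⇒≢ (s≤s x≤M) (sym 1+M≡x)) (proj₂ (proj₂ (∈-partitions⁻ M N λs∈)))

partitions-unique : ∀ M N → Unique (partitions M N)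
partitions-unique M       zero    = [] ∷ []
partitions-unique zero    (suc N) = [] ∷ []
partitions-unique (suc M) (suc N) = Unique.++⁺ (partitions-unique M (suc N))
  (Unique.map⁺ ∷-injectiveʳ (partitions-unique (suc M) N)) disjoint
  where
  disjoint : ∀ {λs} → λs ∈ partitions M (suc N) × λs ∈ map (suc M ∷_) (partitions (suc M) N) → _
  disjoint (λs∈ˡ , λs∈ʳ) with _ , _ , refl ← ∈-map⁻ (suc M ∷_) λs∈ʳ
                         with 1+M≢1+M ∷ _ ← 1+M∉partitions M (suc N) λs∈ˡ = 1+M≢1+M refl

-- Both lists are free of duplicates and have the same members, so each is a permutation of the
-- other and sums may use the recursive enumeration.
boxPartitions↭ : ∀ M N r →
  boxPartitions M N r ↭ filter (λ λs → distinctPartSizes λs ℕ.≟ r) (partitions M N)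
boxPartitions↭ M N r = ∼bag⇒↭ (unique∧set⇒bag (boxPartitions-unique M N r)
  (Unique.filter⁺ (λ λs → distinctPartSizes λs ℕ.≟ r) (partitions-unique M N))
  (mk⇔ to from))
  where
  d≟r = λ λs → distinctPartSizes λs ℕ.≟ r
  to : ∀ {λs} → λs ∈ boxPartitions M N r → λs ∈ filter d≟r (partitions M N)
  to λs∈ = let p , box , d≡r = Equivalence.to (∈-boxPartitions M N r) λs∈
           in ∈-filter⁺ d≟r (∈-partitions⁺ M N (p , box)) d≡r
  from : ∀ {λs} → λs ∈ filter d≟r (partitions M N) → λs ∈ boxPartitions M N r
  from λs∈ = let λs∈p , d≡r = ∈-filter⁻ d≟r {xs = partitions M N} λs∈
                 p , box    = ∈-partitions⁻ M N λs∈p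
             in Equivalence.from (∈-boxPartitions M N r) (p , box , d≡r)

∑-filter-weight : ∀ r xss →
  ∑ (filter (λ λs → distinctPartSizes λs ℕ.≟ r) xss) (λ λs → q^ sum λs) ≗ ∑ xss (weight r)
∑-filter-weight r []         _ = refl
∑-filter-weight r (λs ∷ xss) n with does (distinctPartSizes λs ℕ.≟ r)
... | true  = cong (λ z → (q^ sum λs) n ℤ.+ z) (∑-filter-weight r xss n)
... | false = trans (∑-filter-weight r xss n) (sym (ℤ.+-identityˡ _))

-- Recurrence for the generating function of box partitions

partitionGF : ℕ → ℕ → ℕ → Series
partitionGF M N r = ∑ (partitions M N) (weight r)

boxGF≗partitionGF : ∀ M N r → boxGF M N r ≗ partitionGF M N r
boxGF≗partitionGF M N r = ≗-trans (∑-↭ (λ λs → q^ sum λs) (boxPartitions↭ M N r))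
  (∑-filter-weight r (partitions M N))

-- This counts the partitions in the (M+1) × (N+1) box that have a part `suc M`: `N` bounds the
-- number of parts left after one such part is removed.
maxPartGF : ℕ → ℕ → ℕ → Series
maxPartGF M N r = ∑[ λs ∈ partitions (suc M) N ] weight r (suc M ∷ λs)

partitionGF-split : ∀ M N r → partitionGF (suc M) (suc N) r ≗ partitionGF M (suc N) r ⊕ maxPartGF M N r
partitionGF-split M N r = ≗-trans
  (∑-++ (partitions M (suc N)) (map (suc M ∷_) (partitions (suc M) N)) (weight r))
  (⊕-cong (≗-refl {partitionGF M (suc N) r}) (≡⇒≗ (∑-map (suc M ∷_) (partitions (suc M) N) (weight r))))

∑-weight-new : ∀ M N r →
  (∑[ λs ∈ partitions M N ] weight r (suc M ∷ λs)) ≗ q^ suc M ⊗ shift (partitionGF M N) r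
∑-weight-new M N r = begin
  (∑[ λs ∈ partitions M N ] weight r (suc M ∷ λs))
    ≈⟨ ∑-cong (partitions M N) (λ λs∈ → weight-new r (1+M∉partitions M N λs∈)) ⟩
  (∑[ λs ∈ partitions M N ] q^ suc M ⊗ shift (λ s → weight s λs) r)
    ≈⟨ ∑-⊗ (q^ suc M) (partitions M N) (λ λs → shift (λ s → weight s λs) r) ⟩
  q^ suc M ⊗ (∑[ λs ∈ partitions M N ] shift (λ s → weight s λs) r)
    ≈⟨ ⊗-congˡ (q^ suc M) (∑-shift (partitions M N) weight r) ⟩
  q^ suc M ⊗ shift (partitionGF M N) r ∎
  where open ≗-Reasoning

-- A remainder that still contains `suc M` acquires the factor q^(M+1), any other the factor t
-- q^(M+1). So the remainders in the smaller box need a correction by t - 1, whose negative half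
-- stands on the left.
maxPartGF-step : ∀ M N r → maxPartGF M N r ⊕ q^ suc M ⊗ partitionGF M N r ≗
                           q^ suc M ⊗ (partitionGF (suc M) N r ⊕ shift (partitionGF M N) r)
-- Only the empty remainder is left, so `suc M` is a new size, and `partitionGF (suc M) 0` is
-- `partitionGF M 0` by definition.
maxPartGF-step M zero r = ≗-trans
  (⊕-cong (∑-weight-new M 0 r) (≗-refl {q^ suc M ⊗ partitionGF M 0 r}))
  (solve 3 (λ p x y → p :* x :+ p :* y := p :* (y :+ x)) (λ _ → refl)
    (q^ suc M) (shift (partitionGF M 0) r) (partitionGF M 0 r))
maxPartGF-step M (suc N) r = begin
  maxPartGF M (suc N) r ⊕ p ⊗ S
    ≈⟨ ⊕-cong split (≗-refl {p ⊗ S}) ⟩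
  p ⊗ shift (partitionGF M (suc N)) r ⊕ p ⊗ maxPartGF M N r ⊕ p ⊗ S
    ≈⟨ solve 4 (λ p x y z → p :* x :+ p :* y :+ p :* z := p :* (z :+ y :+ x)) (λ _ → refl)
         p (shift (partitionGF M (suc N)) r) (maxPartGF M N r) S ⟩
  p ⊗ (S ⊕ maxPartGF M N r ⊕ shift (partitionGF M (suc N)) r)
    ≈⟨ ⊗-congˡ p (⊕-cong (partitionGF-split M N r) (≗-refl {shift (partitionGF M (suc N)) r})) ⟨
  p ⊗ (partitionGF (suc M) (suc N) r ⊕ shift (partitionGF M (suc N)) r) ∎
  where
  open ≗-Reasoning
  p S : Series
  p = q^ suc M
  S = partitionGF M (suc N) r
  f : List ℕ → Series
  f λs = weight r (suc M ∷ λs)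
  split : maxPartGF M (suc N) r ≗ p ⊗ shift (partitionGF M (suc N)) r ⊕ p ⊗ maxPartGF M N r
  split = begin
    maxPartGF M (suc N) r
      ≈⟨ ∑-++ (partitions M (suc N)) (map (suc M ∷_) (partitions (suc M) N)) f ⟩
    ∑ (partitions M (suc N)) f ⊕ ∑ (map (suc M ∷_) (partitions (suc M) N)) f
      ≡⟨ cong (∑ (partitions M (suc N)) f ⊕_) (∑-map (suc M ∷_) (partitions (suc M) N) f) ⟩
    ∑ (partitions M (suc N)) f ⊕ ∑ (partitions (suc M) N) (f ∘ (suc M ∷_))
      ≈⟨ ⊕-cong (∑-weight-new M (suc N) r)
           (≗-trans (∑-cong (partitions (suc M) N) (λ {λs} _ → weight-old r (suc M) λs))
                    (∑-⊗ p (partitions (suc M) N) f)) ⟩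
    p ⊗ shift (partitionGF M (suc N)) r ⊕ p ⊗ maxPartGF M N r ∎

partitionGF-step : ∀ M N r → partitionGF (suc M) (suc N) r ⊕ q^ suc M ⊗ partitionGF M N r ≗
  partitionGF M (suc N) r ⊕ q^ suc M ⊗ (partitionGF (suc M) N r ⊕ shift (partitionGF M N) r)
partitionGF-step M N r = begin
  partitionGF (suc M) (suc N) r ⊕ q^ suc M ⊗ partitionGF M N r
    ≈⟨ ⊕-cong (partitionGF-split M N r) (≗-refl {q^ suc M ⊗ partitionGF M N r}) ⟩
  partitionGF M (suc N) r ⊕ maxPartGF M N r ⊕ q^ suc M ⊗ partitionGF M N r
    ≈⟨ (λ i → ℤ.+-assoc (partitionGF M (suc N) r i) (maxPartGF M N r i)
                ((q^ suc M ⊗ partitionGF M N r) i)) ⟩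
  partitionGF M (suc N) r ⊕ (maxPartGF M N r ⊕ q^ suc M ⊗ partitionGF M N r)
    ≈⟨ ⊕-cong (≗-refl {partitionGF M (suc N) r}) (maxPartGF-step M N r) ⟩
  partitionGF M (suc N) r ⊕ q^ suc M ⊗ (partitionGF (suc M) N r ⊕ shift (partitionGF M N) r) ∎
  where open ≗-Reasoning

-- Comparison of the two sides

weight-[] : ∀ r → weight r [] ⊕ 0ₛ ≗ signedC 0 r · 1ₛ
weight-[] zero    n = trans (ℤ.+-identityʳ _) (sym (ℤ.*-identityˡ (1ₛ n)))
weight-[] (suc r) n = sym (cong (_* 1ₛ n) (j<r⇒signedC≡0 {0} {suc r} (s≤s z≤n)))

partitionGF-degenerate : ∀ M N r → M ⊓ N ≡ 0 → partitionGF M N r ≗ signedC 0 r · 1ₛ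
partitionGF-degenerate M       zero    r _ = weight-[] r
partitionGF-degenerate zero    (suc N) r _ = weight-[] r

-- An arbitrary upper limit K is needed for the induction: the recurrence shifts
-- the summation index by one, but M ⊓ N does not drop in each of its terms.
partitionGF≗sieveGF : ∀ K M N r → M ⊓ N ≤ K → partitionGF M N r ≗ sieveGF K M N r
partitionGF≗sieveGF K M N@zero r _ =
  ≗-trans (partitionGF-degenerate M N r (ℕ.⊓-zeroʳ M))
          (≗-sym (sieveGF-degenerate K M N r (ℕ.⊓-zeroʳ M)))
partitionGF≗sieveGF K zero N@(suc _) r _ =
  ≗-trans (partitionGF-degenerate 0 N r refl)
          (≗-sym (sieveGF-degenerate K 0 N r refl))
partitionGF≗sieveGF (suc K) (suc M) (suc N) r M⊓N≤K n =
  -- The q^(M+1) multiples added on the left of the two recurrences agree by `diagonal` and are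
  -- cancelled coefficientwise.
  ∙-cancelʳ ((p ⊗ partitionGF M N r) n) (partitionGF (suc M) (suc N) r n)
    (sieveGF (suc K) (suc M) (suc N) r n) (total n)
  where
  open ≗-Reasoning
  p : Series
  p = q^ suc M
  diagonal : ∀ s → partitionGF M N s ≗ sieveGF K M N s
  diagonal s = partitionGF≗sieveGF K M N s (s≤s⁻¹ M⊓N≤K)
  shifted : ∀ r → shift (partitionGF M N) r ≗ shift (sieveGF K M N) r
  shifted zero    = ≗-refl {0ₛ}
  shifted (suc s) = diagonal s
  total : partitionGF (suc M) (suc N) r ⊕ p ⊗ partitionGF M N r ≗
          sieveGF (suc K) (suc M) (suc N) r ⊕ p ⊗ partitionGF M N r
  total = begin
    partitionGF (suc M) (suc N) r ⊕ p ⊗ partitionGF M N r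
      ≈⟨ partitionGF-step M N r ⟩
    partitionGF M (suc N) r ⊕ p ⊗ (partitionGF (suc M) N r ⊕ shift (partitionGF M N) r)
      ≈⟨ ⊕-cong (partitionGF≗sieveGF (suc K) M (suc N) r
             (ℕ.≤-trans (ℕ.⊓-monoˡ-≤ (suc N) (ℕ.n≤1+n M)) M⊓N≤K))
           (⊗-congˡ p (⊕-cong
             (partitionGF≗sieveGF (suc K) (suc M) N r
               (ℕ.≤-trans (ℕ.⊓-monoʳ-≤ (suc M) (ℕ.n≤1+n N)) M⊓N≤K))
             (shifted r))) ⟩
    sieveGF (suc K) M (suc N) r ⊕ p ⊗ (sieveGF (suc K) (suc M) N r ⊕ shift (sieveGF K M N) r)
      ≈⟨ sieveGF-step K M N r ⟨
    sieveGF (suc K) (suc M) (suc N) r ⊕ p ⊗ sieveGF K M N r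
      ≈⟨ ⊕-cong (≗-refl {sieveGF (suc K) (suc M) (suc N) r}) (⊗-congˡ p (diagonal r)) ⟨
    sieveGF (suc K) (suc M) (suc N) r ⊕ p ⊗ partitionGF M N r ∎

-- Within this range the subtractions are exact, M + N - k = M + (N - k), and the lower index M may
-- be exchanged for its complement N - k.
markedGF≗qBinomials : ∀ M N k → k ≤ M ⊓ N →
  markedGF M N k ≗ q^ (suc k C 2) ⊗ qBinomial M k ⊗ qBinomial (M + N ∸ k) (N ∸ k)
markedGF≗qBinomials M N k k≤M⊓N =
  ⊗-cong (⊗-congˡ (q^ (suc k C 2)) (≗-sym left)) (≗-sym right)
  where
  left : qBinomial M k ≗ gauss M k
  left = subst (λ m → qBinomial m k ≗ gauss m k)
    (ℕ.m∸n+n≡m (ℕ.≤-trans k≤M⊓N (ℕ.m⊓n≤m M N))) (qBinomial≗gauss (M ∸ k) k)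
  right : qBinomial (M + N ∸ k) (N ∸ k) ≗ gauss (M + N ∸ k) M
  right = subst (λ m → qBinomial m (N ∸ k) ≗ gauss m M)
    (sym (ℕ.+-∸-assoc M (ℕ.≤-trans k≤M⊓N (ℕ.m⊓n≤n M N)))) (qBinomial≗gaussᶜ M (N ∸ k))

theorem4 : (M N : ℕ) .{{_ : NonZero M}} .{{_ : NonZero N}} (r : ℕ) → r ≤ M ⊓ N →
    boxGF M N r ≗
    (∑[ r₀ ∈ r ⋯ (M ⊓ N) ]
    ((+ (r₀ C r)) * (-1ℤ ^ (r₀ ∸ r)))
    · (q^ (suc r₀ C 2) ⊗ qBinomial M r₀ ⊗ qBinomial (M + N ∸ r₀) (N ∸ r₀)))
theorem4 M N r r≤M⊓N = begin
  boxGF M N r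
    ≈⟨ boxGF≗partitionGF M N r ⟩
  partitionGF M N r
    -- The free upper limit of the induction is now set to its least admissible value.
    ≈⟨ partitionGF≗sieveGF (M ⊓ N) M N r ℕ.≤-refl ⟩
  (∑[ j ∈ upTo (suc (M ⊓ N)) ] signedC j r · markedGF M N j)
    ≈⟨ ∑-upTo-drop r (suc (M ⊓ N)) (λ j → signedC j r · markedGF M N j)
         (λ {j} j<r n → cong (_* markedGF M N j n) (j<r⇒signedC≡0 j<r)) (ℕ.m≤n⇒m≤1+n r≤M⊓N) ⟩
  (∑[ j ∈ r ⋯ (M ⊓ N) ] signedC j r · markedGF M N j)
    ≈⟨ ∑-cong (r ⋯ (M ⊓ N)) (λ {j} j∈ n →
         cong (signedC j r *_) (markedGF≗qBinomials M N j (upper j∈) n)) ⟩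
  (∑[ j ∈ r ⋯ (M ⊓ N) ]
    signedC j r · (q^ (suc j C 2) ⊗ qBinomial M j ⊗ qBinomial (M + N ∸ j) (N ∸ j))) ∎
  where
  open ≗-Reasoning
  upper : ∀ {j} → j ∈ r ⋯ (M ⊓ N) → j ≤ M ⊓ N
  upper j∈ with i , i< , refl ← ∈-applyUpTo⁻ (r ℕ.+_) j∈ = s≤s⁻¹
    (subst (r + i <_) (ℕ.m+[n∸m]≡n (ℕ.m≤n⇒m≤1+n r≤M⊓N)) (ℕ.+-monoʳ-< r i<))
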